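{- For every integer $n\ge 1$, the number of collapsed permutations in $S_{2n}$ equals the median Genocchi number $H_{2n-1}$.
   Context: A permutation $\pi\in S_N$ is collapsed if for every $k\in[N]$, $\pi^{ -1}(k)\ge \lceil k/2\rceil$ when $N$ is odd (resp. $\pi^{ -1}(k)\ge 1+\lfloor k/2\rfloor$ when $N$ is even), and $\pi^{ -1}(k)\le \lceil N/2\rceil+\lfloor k/2\rfloor$. Seidel triangle: numbers $S_{N,k}$ ($N\ge1$, $k\in\mathbb{Z}$) with $S_{1,2}=1$ and $S_{1,k}=0$ for $k\ne 2$; for $N\ge 2$, $S_{N,k}=0$ if $k<2$ or $k>(N+3)/2$, and otherwise $S_{2m,k}=\sum_{i\ge k}S_{2m-1,i}$ and $S_{2m+1,k}=\sum_{i\le k}S_{2m,i}$. The median Genocchi numbers (Genocchi numbers of the second kind) are $H_{2n-1}=S_{2n,2}$ for $n\ge 1$, giving $H_1=1,H_3=2,H_5=8,H_7=56,H_9=608,\dots$. -}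

module Defs where

open import Data.Nat.Base using (ℕ; zero; suc; _+_; _*_; _≤_; _%_; ⌊_/2⌋; ⌈_/2⌉; _≡ᵇ_; _<ᵇ_)
open import Data.Nat.Properties using (_≤?_)
open import Data.Bool.Base using (Bool; true; false; if_then_else_; _∨_)
open import Data.Fin.Base using (Fin; toℕ)
open import Data.Fin.Properties using (all?) renaming (_≟_ to _≟ᶠ_)
open import Data.Vec.Base using (Vec; []; _∷_; lookup)
open import Data.List.Base using (List; []; _∷_; [_]; map; concatMap; filter; length; upTo; allFin)
open import Data.Nat.ListAction using (sum)
open import Data.Product.Base using (_×_)
open import Relation.Binary.PropositionalEquality using (_≡_)
open import Relation.Nullary.Decidable.Core using (Dec; _×-dec_; _→-dec_)
open import Relation.Unary using (Decidable)

-- Permutations of [N] in one-line notation.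
-- A vector v : Vec (Fin N) N represents the map π(i+1) = (lookup v i)+1
-- (Fin N = {0,…,N-1} is the 0-based copy of [N] = {1,…,N}).
-- It is a permutation iff it is injective.

IsPerm : {N : ℕ} → Vec (Fin N) N → Set
IsPerm {N} v = (i j : Fin N) → lookup v i ≡ lookup v j → i ≡ j

isEven : ℕ → Bool
isEven N = N % 2 ≡ᵇ 0

lowerBd : ℕ → ℕ → ℕ
lowerBd N k = if isEven N then 1 + ⌊ k /2⌋ else ⌈ k /2⌉

upperBd : ℕ → ℕ → ℕ
upperBd N k = ⌈ N /2⌉ + ⌊ k /2⌋

-- π is collapsed: for every k ∈ [N], writing i = π⁻¹(k) (i.e. π(i) = k),
-- lowerBd N k ≤ i ≤ upperBd N k.  (All values converted to 1-based.)
Collapsed : {N : ℕ} → Vec (Fin N) N → Set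
Collapsed {N} v = (k i : Fin N) → lookup v i ≡ k →
  (lowerBd N (suc (toℕ k)) ≤ suc (toℕ i)) × (suc (toℕ i) ≤ upperBd N (suc (toℕ k)))

isPerm? : {N : ℕ} → Decidable (IsPerm {N})
isPerm? v = all? λ i → all? λ j → (lookup v i ≟ᶠ lookup v j) →-dec (i ≟ᶠ j)

collapsed? : {N : ℕ} → Decidable (Collapsed {N})
collapsed? {N} v = all? λ k → all? λ i → (lookup v i ≟ᶠ k) →-dec
  ((lowerBd N (suc (toℕ k)) ≤? suc (toℕ i)) ×-dec (suc (toℕ i) ≤? upperBd N (suc (toℕ k))))

collapsedPerm? : {N : ℕ} → Decidable (λ (v : Vec (Fin N) N) → IsPerm v × Collapsed v)
collapsedPerm? v = isPerm? v ×-dec collapsed? v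

allVecs : (N m : ℕ) → List (Vec (Fin N) m)
allVecs N zero    = [ [] ]
allVecs N (suc m) = concatMap (λ x → map (x ∷_) (allVecs N m)) (allFin N)

numCollapsed : ℕ → ℕ
numCollapsed N = length (filter collapsedPerm? (allVecs N N))

-- Seidel triangle S_{N,k}, for N ≥ 1 and k ∈ ℕ (for k < 0 the entry is 0
-- by definition, so only k ≥ 0 is recorded).  Row 0 is unused (set to 0).
--   S_{1,k} = [k = 2]
--   N ≥ 2: S_{N,k} = 0 if k < 2 or 2k > N+3; otherwise
--     N even: S_{N,k} = Σ_{i ≥ k} S_{N-1,i}
--     N odd : S_{N,k} = Σ_{i ≤ k} S_{N-1,i}
-- The infinite sums are truncated to i ≤ N+3 resp. 0 ≤ i ≤ k; the omitted
-- terms are all zero (row N-1 vanishes outside 2 ≤ i ≤ (N+2)/2).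

seidel : ℕ → ℕ → ℕ
seidel zero k = 0
seidel (suc zero) k = if k ≡ᵇ 2 then 1 else 0
seidel (suc (suc n)) k =
  if (k <ᵇ 2) ∨ (suc (suc n) + 3 <ᵇ 2 * k) then 0
  else (if isEven (suc (suc n))
        then sum (map (λ j → seidel (suc n) (k + j)) (upTo (suc (suc n) + 4)))
        else sum (map (λ i → seidel (suc n) i) (upTo (suc k))))

-- median Genocchi number H_{2n-1} = S_{2n,2}
H : ℕ → ℕ
H n = seidel (2 * n) 2

module Submission where

-- In S_{2n} the conditions say that position i ≤ n takes a value < 2i and position n + i a value ≥ 2i,
-- so the rows of the permanent to be computed come in complementary pairs.  Replacing the second row of
-- a pair by (all values) - (first row) leaves nested rows, which can be filled greedily; pair by pair
-- this gives the recurrence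
--   Q 0 s = s!,   Q (d+1) s = (s+1) Q d (s+1) - s (s+1) Q d s,   number of collapsed permutations = Q n 0,
-- where s is the number of full rows created but not yet filled.
--
-- The Seidel entries are, up to sign, L[t^a (1+t)^b] for the umbral functional L with moments the
-- Genocchi numbers, and S_{2n,2} corresponds to (t(1+t))^n (1+t).  L kills the odd powers (1+t)^{2k+1},
-- k ≥ 1, and the polynomials in t(1+t).  With u = 1+t, the identity
--   u ∏_{1≤j≤x} (u² - j²) = (u + x) ∏_{0≤j<x} (t(1+t) - j(j+1))
-- therefore evaluates L[u ∏_{0≤j<x} (t(1+t) - j(j+1))] to ± x!²: inserting the factors one by one into
-- the Seidel rows turns x! Q n x into a Seidel-like entry, and x = 0 gives Q n 0 = S_{2n,2}.

open import Defs
open import Data.Bool.Base using (Bool; true; false; T; not; _∨_; if_then_else_)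
open import Data.Bool.Properties using (∨-assoc; ∨-comm)
open import Data.Fin.Base using (Fin; zero; suc; toℕ)
open import Data.Fin.Properties using (_≟_; toℕ<n; suc-injective)
open import Data.List.Base
  using (List; []; _∷_; length; replicate; _++_; map; concatMap; filter; tabulate; applyUpTo)
open import Data.List.Properties using (filter-++; filter-none; length-++; ++-identityʳ; map-upTo; applyUpTo-∷ʳ)
open import Data.List.Relation.Binary.Permutation.Propositional as ↭ using (_↭_; prep; swap; ↭-sym; ↭-reflexive)
open import Data.List.Relation.Binary.Permutation.Propositional.Properties using (shift)
open import Data.List.Relation.Unary.All as All using (All; []; _∷_)
open import Data.List.Relation.Unary.Any using (any?)
open import Data.Nat.Base as ℕ
  using (ℕ; zero; suc; _*_; _≤_; _<_; z≤n; s≤s; _<ᵇ_; _∸_; _!; ⌊_/2⌋; ⌈_/2⌉)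
import Data.Nat.Properties as ℕₚ
import Data.Nat.Tactic.RingSolver as ℕ-Solver
open import Data.Product.Base using (_×_; _,_)
open import Data.Unit.Base using (⊤; tt)
open import Data.Vec.Base using (Vec; []; _∷_; lookup)
open import Function.Base using (_∘_; id)
open import Function.Bundles using (mk⇔)
open import Relation.Binary.PropositionalEquality
  using (_≡_; refl; sym; trans; cong; cong₂; subst; module ≡-Reasoning)
open import Relation.Nullary using (¬_; does; yes; no; contradiction)
open import Relation.Nullary.Decidable using (does-⇔)
open import Relation.Unary using (Decidable)

-- Local recurrences of the Seidel triangle

module SeidelTriangle where
  open import Data.Nat.Base
  open import Data.Nat.Properties
  open import Data.Nat.ListAction using (sum)
  open import Data.Nat.ListAction.Properties using (sum-++)

  double : ℕ → ℕ
  double zero    = zero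
  double (suc m) = suc (suc (double m))

  double≡2* : ∀ m → double m ≡ 2 * m
  double≡2* zero    = refl
  double≡2* (suc m) = trans (cong (2 +_) (double≡2* m)) (sym (*-suc 2 m))

  isEven-double : ∀ m → isEven (double m) ≡ true
  isEven-double zero    = refl
  isEven-double (suc m) = isEven-double m

  isEven-1+double : ∀ m → isEven (suc (double m)) ≡ false
  isEven-1+double zero    = refl
  isEven-1+double (suc m) = isEven-1+double m

  <ᵇ-true : ∀ {m n} → m < n → (m <ᵇ n) ≡ true
  <ᵇ-true {m} {n} m<n with m <ᵇ n | <⇒<ᵇ m<n
  ... | true | _ = refl

  <ᵇ-false : ∀ {m n} → n ≤ m → (m <ᵇ n) ≡ false
  <ᵇ-false {m} {n} n≤m with m <ᵇ n in eq
  ... | false = refl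
  ... | true  = contradiction (<ᵇ⇒< m n (subst T (sym eq) _)) (≤⇒≯ n≤m)

  sum-zero : ∀ (f : ℕ → ℕ) n → (∀ j → f j ≡ 0) → sum (applyUpTo f n) ≡ 0
  sum-zero f zero    f≡0 = refl
  sum-zero f (suc n) f≡0 rewrite f≡0 0 = sum-zero (λ j → f (suc j)) n (λ j → f≡0 (suc j))

  sum-snoc : ∀ (f : ℕ → ℕ) n → sum (applyUpTo f (suc n)) ≡ sum (applyUpTo f n) + f n
  sum-snoc f n = trans (cong sum (sym (applyUpTo-∷ʳ f n)))
    (trans (sum-++ (applyUpTo f n) (f n ∷ [])) (cong (sum (applyUpTo f n) +_) (+-identityʳ (f n))))

  applyUpTo-cong : ∀ {a} {A : Set a} {f g : ℕ → A} n → (∀ j → j < n → f j ≡ g j) →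
    applyUpTo f n ≡ applyUpTo g n
  applyUpTo-cong zero    eq = refl
  applyUpTo-cong (suc n) eq = cong₂ _∷_ (eq 0 z<s) (applyUpTo-cong n (λ j j<n → eq (suc j) (s<s j<n)))

  seidel-low : ∀ N k → k < 2 → seidel N k ≡ 0
  seidel-low zero          k       k<2 = refl
  seidel-low (suc zero)    zero    k<2 = refl
  seidel-low (suc zero)    (suc zero) k<2 = refl
  seidel-low (suc zero)    (suc (suc k)) (s<s (s<s ()))
  seidel-low (suc (suc N)) k       k<2 rewrite <ᵇ-true k<2 = refl

  seidel-high : ∀ N k → N + 3 < 2 * k → seidel N k ≡ 0
  seidel-high zero          k h = refl
  seidel-high (suc zero)    zero h = refl
  seidel-high (suc zero)    (suc zero) h = refl
  seidel-high (suc zero)    (suc (suc zero)) (s<s (s<s (s<s (s<s ()))))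
  seidel-high (suc zero)    (suc (suc (suc k))) h = refl
  seidel-high (suc (suc N)) k h with k <ᵇ 2
  ... | true = refl
  ... | false rewrite <ᵇ-true h = refl

  -- For k beyond the range of row 2 + N all terms of the suffix sum vanish as well.
  seidel-even : ∀ N k → isEven (2 + N) ≡ true → 2 ≤ k →
    seidel (2 + N) k ≡ sum (applyUpTo (λ j → seidel (1 + N) (k + j)) (2 + N + 4))
  seidel-even N k even 2≤k rewrite <ᵇ-false 2≤k with 2 + N + 3 <ᵇ 2 * k in eq
  ... | false rewrite even = cong sum (map-upTo (λ j → seidel (1 + N) (k + j)) (2 + N + 4))
  ... | true  = sym (sum-zero (λ j → seidel (1 + N) (k + j)) (2 + N + 4) λ j → seidel-high (1 + N) (k + j)
      (<-≤-trans (<-trans (n<1+n _) (<ᵇ⇒< (2 + N + 3) (2 * k) (subst T (sym eq) _))) (*-monoʳ-≤ 2 (m≤m+n k j))))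

  seidel-even-step : ∀ N k → isEven (2 + N) ≡ true → 2 ≤ k →
    seidel (2 + N) (suc k) + seidel (1 + N) k ≡ seidel (2 + N) k
  seidel-even-step N k even 2≤k = begin
    seidel (2 + N) (suc k) + row k             ≡⟨ cong₂ _+_ next (cong row (sym (+-identityʳ k))) ⟩
    sum (applyUpTo (λ j → f (suc j)) n) + f 0  ≡⟨ +-comm _ (f 0) ⟩
    sum (applyUpTo f (suc n))                  ≡⟨ sum-snoc f n ⟩
    -- Both suffix sums are cut at the same length, so the one starting at `suc k` reaches one index
    -- further; that entry lies beyond the row.
    sum (applyUpTo f n) + f n                  ≡⟨ cong (sum (applyUpTo f n) +_) (seidel-high (1 + N) (k + n) high) ⟩
    sum (applyUpTo f n) + 0                    ≡⟨ +-identityʳ _ ⟩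
    sum (applyUpTo f n)                        ≡⟨ seidel-even N k even 2≤k ⟨
    seidel (2 + N) k                           ∎
    where
    n = 2 + N + 4
    row f : ℕ → ℕ
    row = seidel (1 + N)
    f j = row (k + j)
    next : seidel (2 + N) (suc k) ≡ sum (applyUpTo (λ j → f (suc j)) n)
    next = trans (seidel-even N (suc k) even (m≤n⇒m≤1+n 2≤k))
                 (cong sum (applyUpTo-cong n (λ j _ → cong row (sym (+-suc k j)))))
    high : 1 + N + 3 < 2 * (k + n)
    high = ≤-trans (s≤s (+-monoʳ-≤ (1 + N) (n≤1+n 3))) (≤-trans (m≤n+m n k) (m≤m+n (k + n) _))
    open ≡-Reasoning

  seidel-odd : ∀ N k → isEven (2 + N) ≡ false → 2 ≤ k → 2 * k ≤ 2 + N + 3 →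
    seidel (2 + N) k ≡ sum (applyUpTo (seidel (1 + N)) (suc k))
  seidel-odd N k odd 2≤k k≤ rewrite <ᵇ-false 2≤k | <ᵇ-false k≤ | odd =
    cong sum (map-upTo (seidel (1 + N)) (suc k))

  seidel-odd-step : ∀ N k → isEven (2 + N) ≡ false → 1 ≤ k → 2 * suc k ≤ 2 + N + 3 →
    seidel (2 + N) (suc k) ≡ seidel (1 + N) (suc k) + seidel (2 + N) k
  seidel-odd-step N k odd 1≤k k≤ = begin
    seidel (2 + N) (suc k)                     ≡⟨ seidel-odd N (suc k) odd (s≤s 1≤k) k≤ ⟩
    sum (applyUpTo row (suc (suc k)))          ≡⟨ sum-snoc row (suc k) ⟩
    sum (applyUpTo row (suc k)) + row (suc k)  ≡⟨ +-comm _ (row (suc k)) ⟩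
    row (suc k) + sum (applyUpTo row (suc k))  ≡⟨ cong (row (suc k) +_) (prefix k 1≤k (≤-trans (*-monoʳ-≤ 2 (n≤1+n k)) k≤)) ⟨
    row (suc k) + seidel (2 + N) k             ∎
    where
    open ≡-Reasoning
    row : ℕ → ℕ
    row = seidel (1 + N)
    prefix : ∀ k → 1 ≤ k → 2 * k ≤ 2 + N + 3 → seidel (2 + N) k ≡ sum (applyUpTo row (suc k))
    -- Column 1 is outside the range of `seidel-odd`, but both sides vanish because columns 0 and 1
    -- are zero.
    prefix (suc zero)    _ _ = sym (cong₂ (λ x y → x + (y + 0))
      (seidel-low (1 + N) 0 z<s) (seidel-low (1 + N) 1 (n<1+n 1)))
    prefix (suc (suc k)) _ h = seidel-odd N (2 + k) odd (s≤s (s≤s z≤n)) h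

  -- S_{2m,2+i} and S_{2m-1,1+i}.  The value evenRow 0 0 = 1 continues the triangle upwards:
  -- it makes the recurrences below hold from row 1 on.
  evenRow oddRow : ℕ → ℕ → ℕ
  evenRow zero    zero    = 1
  evenRow zero    (suc i) = 0
  evenRow (suc m) i       = seidel (double (suc m)) (2 + i)
  oddRow zero    i = 0
  oddRow (suc m) i = seidel (suc (double m)) (1 + i)

  -- The bound `i ≤ m` keeps column 2 + i inside row 2m + 1; further right the row is cut to 0 while
  -- prefix sums are not. At m = 0 the artificial entry `evenRow 0 0` supplies S_{1,2} = 1.
  oddRow-suc : ∀ m i → i ≤ m → oddRow (suc m) (suc i) ≡ evenRow m i + oddRow (suc m) i
  oddRow-suc zero    zero    _   = refl
  oddRow-suc (suc m) i       i≤m = seidel-odd-step (suc (double m)) (suc i) (isEven-1+double m) (s≤s z≤n) bound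
    where
    ring : ∀ m → 2 * (3 + m) ≡ 2 + suc (2 * m) + 3
    ring = ℕ-Solver.solve-∀
    bound : 2 * (2 + i) ≤ 2 + suc (double m) + 3
    bound rewrite double≡2* m = ≤-trans (*-monoʳ-≤ 2 (s≤s (s≤s i≤m))) (≤-reflexive (ring m))

  evenRow-suc : ∀ m i → evenRow (suc m) (suc i) + oddRow (suc m) (suc i) ≡ evenRow (suc m) i
  evenRow-suc m i = seidel-even-step (double m) (2 + i) (isEven-double m) (s≤s (s≤s z≤n))

  evenRow-edge : ∀ m → evenRow (suc m) (suc m) ≡ 0
  evenRow-edge m = seidel-high (double (suc m)) (3 + m) bound
    where
    ring : ∀ m → suc (2 + 2 * m + 3) ≡ 2 * (3 + m)
    ring = ℕ-Solver.solve-∀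
    bound : double (suc m) + 3 < 2 * (3 + m)
    bound rewrite double≡2* m = ≤-reflexive (ring m)

open SeidelTriangle

-- From here on _·_ is the product of integers; _*_ remains that of natural numbers.
open import Data.Integer.Base using (ℤ; +_; 0ℤ; 1ℤ; _+_; _-_) renaming (_*_ to _·_)
import Data.Integer.Properties as ℤₚ
open import Data.Integer.Tactic.RingSolver using (solve-∀)
open import Algebra.Properties.Semiring.Sum ℤₚ.+-*-semiring
  using (sum; sum-cong-≗; ∑-distrib-+; ∑-comm; *-distribˡ-sum; *-distribʳ-sum)

-- The recurrence `Q` and its solution by Seidel entries

!-suc : ∀ s → + (suc s !) ≡ (1ℤ + + s) · + (s !)
!-suc s = ℤₚ.pos-* (suc s) (s !)

Q : ℕ → ℕ → ℤ
Q zero    s = + (s !)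
Q (suc d) s = (1ℤ + + s) · Q d (suc s) - (1ℤ + + s) · (+ s · Q d s)

-- Let u = 1 + t. Up to sign, `e a i` stands for L[(tu)^a u^{2i+1}] and `o a i` for
-- L[(tu)^a u^{2i}]. Then `o-suc` and `e-suc` both express u² = tu + u, `o-zero` says that L kills
-- the polynomials in tu, `e-edge` that it kills u³, u⁵, ..., and `e-top` that L[u] = 1. The signs
-- are (-1)^{a+i} for `e` and the opposite for `o`.
module MedianRecurrence
  (e o : ℕ → ℕ → ℤ)
  (o-suc  : ∀ a i → o a (suc i) ≡ e a i + o (suc a) i)
  (e-suc  : ∀ a i → e a (suc i) ≡ e (suc a) i - o a (suc i))
  (o-zero : ∀ a → o a 0 ≡ 0ℤ)
  (e-top  : e 0 0 ≡ 1ℤ)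
  (e-edge : ∀ i → e 0 (suc i) ≡ 0ℤ)
  where

  -- Up to sign, this multiplies the argument of L by ∏_{0≤j<x} (t(1+t) - j(j+1)).
  iterate : (ℕ → ℕ → ℤ) → ℕ → ℕ → ℕ → ℤ
  iterate f zero    a i = f a i
  iterate f (suc x) a i = iterate f x (suc a) i + + x · (1ℤ + + x) · iterate f x a i

  E O : ℕ → ℕ → ℕ → ℤ
  E = iterate e
  O = iterate o

  O-suc : ∀ x a i → O x a (suc i) ≡ E x a i + O x (suc a) i
  O-suc zero    a i = o-suc a i
  O-suc (suc x) a i rewrite O-suc x (suc a) i | O-suc x a i =
    lemma (+ x · (1ℤ + + x)) (E x (suc a) i) (O x (suc (suc a)) i) (E x a i) (O x (suc a) i)
    where
    lemma : ∀ c p q r s → (p + q) + c · (r + s) ≡ (p + c · r) + (q + c · s)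
    lemma = solve-∀

  E-suc : ∀ x a i → E x a (suc i) ≡ E x (suc a) i - O x a (suc i)
  E-suc zero    a i = e-suc a i
  E-suc (suc x) a i rewrite E-suc x (suc a) i | E-suc x a i =
    lemma (+ x · (1ℤ + + x)) (E x (suc (suc a)) i) (O x (suc a) (suc i)) (E x (suc a) i) (O x a (suc i))
    where
    lemma : ∀ c p q r s → (p - q) + c · (r - s) ≡ (p + c · r) - (q + c · s)
    lemma = solve-∀

  O-zero : ∀ x a → O x a 0 ≡ 0ℤ
  O-zero zero    a = o-zero a
  O-zero (suc x) a rewrite O-zero x (suc a) | O-zero x a = lemma (+ x · (1ℤ + + x))
    where
    lemma : ∀ c → 0ℤ + c · 0ℤ ≡ 0ℤ
    lemma = solve-∀

  -- Up to sign, L[u^{2i+1} ∏_{1≤j≤x} (u² - j²)].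
  C : ℕ → ℕ → ℤ
  C x i = E x 0 i - + x · O x 0 i

  -- Induction step of the product identity: (u + x + 1)(tu - x(x+1)) = (u + x)(u² - (x+1)²). The
  -- alternating signs turn the subtraction of (x+1)² into an addition.
  C-suc : ∀ x i → C (suc x) i ≡ C x (suc i) + (1ℤ + + x) · (1ℤ + + x) · C x i
  C-suc x i =
    lemma (+ x) (E x 0 i) (O x 0 i) (E x 0 (suc i)) (O x 0 (suc i)) (E x 1 i) (O x 1 i)
      (E-suc x 0 i) (O-suc x 0 i)
    where
    identity : ∀ x e₀ o₀ e′ o′ →
      (e′ + x · (1ℤ + x) · e₀) - (1ℤ + x) · (o′ + x · (1ℤ + x) · o₀)
      ≡ (e′ - (e₀ + o′) - x · (e₀ + o′)) + (1ℤ + x) · (1ℤ + x) · (e₀ - x · o₀)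
    identity = solve-∀
    lemma : ∀ x e₀ o₀ e₁ o₁ e′ o′ → e₁ ≡ e′ - o₁ → o₁ ≡ e₀ + o′ →
      (e′ + x · (1ℤ + x) · e₀) - (1ℤ + x) · (o′ + x · (1ℤ + x) · o₀)
      ≡ (e₁ - x · o₁) + (1ℤ + x) · (1ℤ + x) · (e₀ - x · o₀)
    lemma x e₀ o₀ _ _ e′ o′ refl refl = identity x e₀ o₀ e′ o′

  -- Expanding the product leaves only odd powers from u³ on, all killed by L.
  C-edge : ∀ x i → C x (suc i) ≡ 0ℤ
  C-edge zero    i rewrite e-edge i = refl
  C-edge (suc x) i rewrite C-suc x (suc i) | C-edge x (suc i) | C-edge x i =
    lemma ((1ℤ + + x) · (1ℤ + + x))
    where
    lemma : ∀ c → 0ℤ + c · 0ℤ ≡ 0ℤ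
    lemma = solve-∀

  -- By `C-edge` only the lowest term of the product, u ∏ (-j²), contributes.
  C-corner : ∀ x → C x 0 ≡ + (x !) · + (x !)
  C-corner zero    rewrite e-top = refl
  C-corner (suc x) rewrite C-suc x 0 | C-edge x 0 | C-corner x =
    trans (lemma (1ℤ + + x) (+ (x !))) (sym (cong₂ _·_ (!-suc x) (!-suc x)))
    where
    lemma : ∀ c f → 0ℤ + c · c · (f · f) ≡ (c · f) · (c · f)
    lemma = solve-∀

  -- The other term of `C x 0` is L of a polynomial in t(1+t), hence 0.
  E-corner : ∀ x → E x 0 0 ≡ + (x !) · + (x !)
  E-corner x = trans (lemma (+ x) (E x 0 0) (O-zero x 0)) (C-corner x)
    where
    lemma : ∀ x p {q} → q ≡ 0ℤ → p ≡ p - x · q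
    lemma x p refl = identity x p
      where
      identity : ∀ x p → p ≡ p - x · 0ℤ
      identity = solve-∀

  -- Solving the definition of `iterate` for `E x (suc n) 0` gives the recurrence of `Q` multiplied
  -- by x!, since (x+1) x! = (x+1)!. The start n = 0 needs x! · x!, which is `E-corner`.
  Q-E : ∀ n x → + (x !) · Q n x ≡ E x n 0
  Q-E zero    x = sym (E-corner x)
  Q-E (suc n) x = lemma (+ x) (+ (x !)) (Q n (suc x)) (Q n x) (E x (suc n) 0) (E x n 0)
      (trans (cong (_· Q n (suc x)) (sym (!-suc x))) (Q-E n (suc x))) (Q-E n x)
    where
    lemma : ∀ x f q q₁ p r → (1ℤ + x) · f · q ≡ p + x · (1ℤ + x) · r → f · q₁ ≡ r →
      f · ((1ℤ + x) · q - (1ℤ + x) · (x · q₁)) ≡ p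
    lemma x f q q₁ p _ eq refl = trans (ring₁ x f q q₁)
      (trans (cong (λ w → w - (1ℤ + x) · x · (f · q₁)) eq) (ring₂ x p (f · q₁)))
      where
      ring₁ : ∀ x f q q₁ → f · ((1ℤ + x) · q - (1ℤ + x) · (x · q₁)) ≡ (1ℤ + x) · f · q - (1ℤ + x) · x · (f · q₁)
      ring₁ = solve-∀
      ring₂ : ∀ x p r → (p + x · (1ℤ + x) · r) - (1ℤ + x) · x · r ≡ p
      ring₂ = solve-∀

  Q≡e : ∀ n → Q n 0 ≡ e n 0
  Q≡e n = trans (sym (ℤₚ.*-identityˡ (Q n 0))) (Q-E n 0)

-- The row index is a + i: a factor t(1+t) moves one row down in the same column, a factor (1+t)²
-- one row down and one column to the right.
e o : ℕ → ℕ → ℤ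
e a i = + evenRow (a ℕ.+ i) i
o a i = + oddRow (a ℕ.+ i) i

o-suc : ∀ a i → o a (suc i) ≡ e a i + o (suc a) i
o-suc a i rewrite ℕₚ.+-suc a i = cong +_ (oddRow-suc (a ℕ.+ i) i (ℕₚ.m≤n+m i a))

e-suc : ∀ a i → e a (suc i) ≡ e (suc a) i - o a (suc i)
e-suc a i rewrite ℕₚ.+-suc a i | sym (evenRow-suc (a ℕ.+ i) i) =
  cancel (+ evenRow (suc (a ℕ.+ i)) (suc i)) (+ oddRow (suc (a ℕ.+ i)) (suc i))
  where
  cancel : ∀ p q → p ≡ (p + q) - q
  cancel = solve-∀

o-zero : ∀ a → o a 0 ≡ 0ℤ
o-zero a with a ℕ.+ 0
... | zero  = refl
... | suc m = cong +_ (seidel-low (suc (double m)) 1 (ℕₚ.n<1+n 1))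

e-edge : ∀ i → e 0 (suc i) ≡ 0ℤ
e-edge i = cong +_ (evenRow-edge i)

Q≡H : ∀ n → 1 ≤ n → Q n 0 ≡ + H n
Q≡H n@(suc m) _ = begin
  Q n 0            ≡⟨ MedianRecurrence.Q≡e e o o-suc e-suc o-zero refl e-edge n ⟩
  e n 0            ≡⟨ cong (λ k → + evenRow k 0) (ℕₚ.+-identityʳ n) ⟩
  + evenRow n 0    ≡⟨ cong (λ N → + seidel N 2) (double≡2* n) ⟩
  + H n            ∎
  where open ≡-Reasoning

-- Counting distinct choices from a list of rows

Row : ℕ → Set
Row N = Fin N → Bool

ind : Bool → ℤ
ind true  = 1ℤ
ind false = 0ℤ

ind-not-∨ : ∀ a b → ind (not (a ∨ b)) ≡ ind (not a) · ind (not b)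
ind-not-∨ true  b = refl
ind-not-∨ false b = sym (ℤₚ.*-identityˡ _)

module _ {N : ℕ} where

  used : List (Fin N) → Row N
  used u x = does (any? (x ≟_) u)

  -- The number of ways to choose pairwise distinct values outside u, one satisfying each row.
  ways : List (Fin N) → List (Row N) → ℤ
  waysFrom : List (Fin N) → Row N → List (Row N) → Fin N → ℤ

  ways u []       = 1ℤ
  ways u (c ∷ cs) = sum (waysFrom u c cs)

  waysFrom u c cs x = ind (c x) · (ind (not (used u x)) · ways (x ∷ u) cs)

  does-≟-sym : ∀ (x y : Fin N) → does (x ≟ y) ≡ does (y ≟ x)
  does-≟-sym x y = does-⇔ (mk⇔ sym sym) (x ≟ y) (y ≟ x)

  -- Swapping two rows reverses the order in which their values enter `u`; only membership may
  -- matter.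
  ways-cong-used : ∀ {u u′} → (∀ x → used u x ≡ used u′ x) → ∀ cs → ways u cs ≡ ways u′ cs
  ways-cong-used u≗u′ []       = refl
  ways-cong-used u≗u′ (c ∷ cs) = sum-cong-≗ λ x → cong (ind (c x) ·_)
    (cong₂ _·_ (cong (ind ∘ not) (u≗u′ x))
               (ways-cong-used (λ y → cong (does (y ≟ x) ∨_) (u≗u′ y)) cs))

  ways-cong-tail : ∀ u c {cs ds} → (∀ x → ways (x ∷ u) cs ≡ ways (x ∷ u) ds) → ways u (c ∷ cs) ≡ ways u (c ∷ ds)
  ways-cong-tail u c eq = sum-cong-≗ λ x → cong (λ w → ind (c x) · (ind (not (used u x)) · w)) (eq x)

  -- After the two sums are exchanged the terms agree, because x ∉ u, y ∉ u and x ≠ y together are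
  -- symmetric in x and y.
  ways-swap : ∀ u c d cs → ways u (c ∷ d ∷ cs) ≡ ways u (d ∷ c ∷ cs)
  ways-swap u c d cs = begin
    ways u (c ∷ d ∷ cs)                  ≡⟨ sum-cong-≗ (λ x → expand c d x) ⟩
    sum (λ x → sum (term c d x))         ≡⟨ ∑-comm (term c d) ⟩
    sum (λ y → sum (λ x → term c d x y)) ≡⟨ sum-cong-≗ (λ y → sum-cong-≗ λ x → symmetric x y) ⟩
    sum (λ y → sum (term d c y))         ≡⟨ sum-cong-≗ (λ y → expand d c y) ⟨
    ways u (d ∷ c ∷ cs)                  ∎
    where
    open ≡-Reasoning
    term : Row N → Row N → Fin N → Fin N → ℤ
    term c d x y = ind (c x) · (ind (not (used u x)) ·
      (ind (d y) · (ind (not (used (x ∷ u) y)) · ways (y ∷ x ∷ u) cs)))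
    expand : ∀ c d x → ind (c x) · (ind (not (used u x)) · ways (x ∷ u) (d ∷ cs)) ≡ sum (term c d x)
    expand c d x = trans
      (cong (ind (c x) ·_) (*-distribˡ-sum (ind (not (used u x))) (waysFrom (x ∷ u) d cs)))
      (*-distribˡ-sum (ind (c x)) (λ y → ind (not (used u x)) · waysFrom (x ∷ u) d cs y))
    ring : ∀ p q r s e w → p · (q · (r · ((e · s) · w))) ≡ r · (s · (p · ((e · q) · w)))
    ring = solve-∀
    used-swap : ∀ x y z → used (y ∷ x ∷ u) z ≡ used (x ∷ y ∷ u) z
    used-swap x y z = trans (sym (∨-assoc (does (z ≟ y)) (does (z ≟ x)) _))
      (trans (cong (_∨ used u z) (∨-comm (does (z ≟ y)) (does (z ≟ x)))) (∨-assoc (does (z ≟ x)) (does (z ≟ y)) _))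
    symmetric : ∀ x y → term c d x y ≡ term d c y x
    symmetric x y = begin
      p · (q · (r · (ind (not (used (x ∷ u) y)) · ways (y ∷ x ∷ u) cs)))
        ≡⟨ cong₂ (λ v w → p · (q · (r · (v · w)))) (ind-not-∨ (does (y ≟ x)) (used u y))
             (ways-cong-used {y ∷ x ∷ u} {x ∷ y ∷ u} (used-swap x y) cs) ⟩
      p · (q · (r · ((ind (not (does (y ≟ x))) · s) · w)))
        ≡⟨ ring p q r s (ind (not (does (y ≟ x)))) w ⟩
      r · (s · (p · ((ind (not (does (y ≟ x))) · q) · w)))
        ≡⟨ cong (λ b → r · (s · (p · ((ind (not b) · q) · w)))) (does-≟-sym y x) ⟩
      r · (s · (p · ((ind (not (does (x ≟ y))) · q) · w)))
        ≡⟨ cong (λ v → r · (s · (p · (v · w)))) (ind-not-∨ (does (x ≟ y)) (used u x)) ⟨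
      r · (s · (p · (ind (not (used (y ∷ u) x)) · w)))
        ∎
      where
      p = ind (c x)
      q = ind (not (used u x))
      r = ind (d y)
      s = ind (not (used u y))
      w = ways (x ∷ y ∷ u) cs

  -- This freedom of order lets position i be processed next to position n + i.
  ways-↭ : ∀ {cs ds} → cs ↭ ds → ∀ u → ways u cs ≡ ways u ds
  ways-↭ ↭.refl u = refl
  ways-↭ (prep {xs = cs} {ds} c p) u = ways-cong-tail u c {cs} {ds} (λ x → ways-↭ p (x ∷ u))
  ways-↭ (swap {xs = cs} {ds} c d p) u = trans (ways-swap u c d cs)
    (ways-cong-tail u d {c ∷ cs} {c ∷ ds} λ x → ways-cong-tail (x ∷ u) c {cs} {ds} λ y → ways-↭ p (y ∷ x ∷ u))
  ways-↭ (↭.trans p q) u = trans (ways-↭ p u) (ways-↭ q u)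

  full : Row N
  full _ = true

  ways-complement : ∀ u c cs → ways u ((not ∘ c) ∷ cs) + ways u (c ∷ cs) ≡ ways u (full ∷ cs)
  ways-complement u c cs = trans (sym (∑-distrib-+ (waysFrom u (not ∘ c) cs) (waysFrom u c cs)))
    (sum-cong-≗ λ x → pointwise (c x) (ind (not (used u x)) · ways (x ∷ u) cs))
    where
    pointwise : ∀ b w → ind (not b) · w + ind b · w ≡ 1ℤ · w
    pointwise true  w = ℤₚ.+-identityˡ (1ℤ · w)
    pointwise false w = ℤₚ.+-identityʳ (1ℤ · w)

  ways-complement₂ : ∀ u b c cs → ways u (b ∷ (not ∘ c) ∷ cs) + ways u (b ∷ c ∷ cs) ≡ ways u (b ∷ full ∷ cs)
  ways-complement₂ u b c cs = trans
    (sym (∑-distrib-+ (waysFrom u b ((not ∘ c) ∷ cs)) (waysFrom u b (c ∷ cs)))) (sum-cong-≗ λ x →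
    trans (ring (ind (b x)) (ind (not (used u x))) (ways (x ∷ u) ((not ∘ c) ∷ cs)) (ways (x ∷ u) (c ∷ cs)))
            (cong (λ w → ind (b x) · (ind (not (used u x)) · w)) (ways-complement (x ∷ u) c cs)))
    where
    ring : ∀ p q r s → p · (q · r) + p · (q · s) ≡ p · (q · (r + s))
    ring = solve-∀

  -- Greedy filling of nested rows

  avail : List (Fin N) → Row N → ℤ
  avail u c = sum λ x → ind (c x) · ind (not (used u x))

  -- When the number of continuations is the same for every admissible value, the sum factors;
  -- nested rows provide this.
  ways-const : ∀ u c cs q → (∀ x → T (c x) → used u x ≡ false → ways (x ∷ u) cs ≡ q) →
    ways u (c ∷ cs) ≡ avail u c · q
  ways-const u c cs q eq = trans (sum-cong-≗ λ x → pointwise (c x) (used u x) (eq x))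
    (sym (*-distribʳ-sum q λ x → ind (c x) · ind (not (used u x))))
    where
    pointwise : ∀ a b {w} → (T a → b ≡ false → w ≡ q) → ind a · (ind (not b) · w) ≡ ind a · ind (not b) · q
    pointwise false b     h = refl
    pointwise true  true  h = refl
    pointwise true  false h rewrite h tt refl = ℤₚ.*-identityˡ (1ℤ · q)

  Distinct : List (Fin N) → Set
  Distinct []      = ⊤
  Distinct (y ∷ u) = used u y ≡ false × Distinct u

sum-δ : ∀ {N} (y : Fin N) (f : Fin N → ℤ) → sum (λ x → ind (does (x ≟ y)) · f x) ≡ f y
sum-δ zero    f = trans (cong₂ _+_ (ℤₚ.*-identityˡ (f zero)) (sum-0 (f ∘ suc))) (ℤₚ.+-identityʳ (f zero))
  where
  sum-0 : ∀ {N} (f : Fin N → ℤ) → sum (λ x → 0ℤ · f x) ≡ 0ℤ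
  sum-0 {zero}  f = refl
  sum-0 {suc N} f = trans (ℤₚ.+-identityˡ _) (sum-0 (f ∘ suc))
sum-δ (suc y) f = trans (ℤₚ.+-identityˡ _) (sum-δ y (f ∘ suc))

avail-∷ : ∀ {N} (y : Fin N) u c → T (c y) → used u y ≡ false → avail (y ∷ u) c + 1ℤ ≡ avail u c
avail-∷ y u c cy y∉u = begin
  avail (y ∷ u) c + 1ℤ
    -- The 1 is spread out as a sum concentrated at `y`, so that the two sums can be added termwise.
    ≡⟨ cong (λ w → avail (y ∷ u) c + w) (trans (sum-δ y f) (at-y (c y) cy y∉u)) ⟨
  avail (y ∷ u) c + sum (λ x → ind (does (x ≟ y)) · f x)
    ≡⟨ ∑-distrib-+ (λ x → ind (c x) · ind (not (used (y ∷ u) x))) (λ x → ind (does (x ≟ y)) · f x) ⟨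
  sum (λ x → ind (c x) · ind (not (used (y ∷ u) x)) + ind (does (x ≟ y)) · f x)
    ≡⟨ sum-cong-≗ (λ x → pointwise (does (x ≟ y)) (ind (c x)) (used u x)) ⟩
  avail u c ∎
  where
  open ≡-Reasoning
  f : Fin _ → ℤ
  f x = ind (c x) · ind (not (used u x))
  at-y : ∀ a {b} → T a → b ≡ false → ind a · ind (not b) ≡ 1ℤ
  at-y true _ refl = refl
  pointwise : ∀ b p q → p · ind (not (b ∨ q)) + ind b · (p · ind (not q)) ≡ p · ind (not q)
  pointwise true  p q = ring p (ind (not q))
    where
    ring : ∀ p q → p · 0ℤ + 1ℤ · (p · q) ≡ p · q
    ring = solve-∀
  pointwise false p q = ring (p · ind (not q))
    where
    ring : ∀ p → p + 0ℤ · p ≡ p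
    ring = solve-∀

-- Nestedness enters through `All (T ∘ c) u`: each value used so far lies in `c` and takes away
-- exactly one choice.
avail-length : ∀ {N} (u : List (Fin N)) c → Distinct u → All (T ∘ c) u → avail u c + + length u ≡ sum (ind ∘ c)
avail-length []      c _            _          = trans (ℤₚ.+-identityʳ _) (sum-cong-≗ λ x → ℤₚ.*-identityʳ (ind (c x)))
avail-length (y ∷ u) c (y∉u , dist) (cy ∷ all) = trans (sym (ℤₚ.+-assoc (avail (y ∷ u) c) 1ℤ (+ length u)))
  (trans (cong (_+ + length u) (avail-∷ y u c cy y∉u)) (avail-length u c dist all))

avail-≡ : ∀ {N} {t s} (u : List (Fin N)) c → Distinct u → All (T ∘ c) u →
  sum (ind ∘ c) ≡ + t → length u ℕ.+ s ≡ t → avail u c ≡ + s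
avail-≡ {t = t} {s} u c dist all size refl = begin
  avail u c                             ≡⟨ ring (avail u c) (+ length u) ⟩
  (avail u c + + length u) - + length u ≡⟨ cong (_- + length u) (trans (avail-length u c dist all) size) ⟩
  (+ length u + + s) - + length u       ≡⟨ ring′ (+ length u) (+ s) ⟩
  + s                                   ∎
  where
  open ≡-Reasoning
  ring : ∀ a b → a ≡ (a + b) - b
  ring = solve-∀
  ring′ : ∀ a b → (a + b) - a ≡ b
  ring′ = solve-∀

-- Initial segments and the complementary pairs of rows

below : ∀ {N} → ℕ → Row N
below t x = toℕ x <ᵇ t

sum-full : ∀ N → sum (ind ∘ full {N}) ≡ + N
sum-full zero    = refl
sum-full (suc N) = cong (λ w → 1ℤ + w) (sum-full N)

sum-below : ∀ N t → t ≤ N → sum (ind ∘ below {N} t) ≡ + t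
sum-below zero    zero    _         = refl
sum-below (suc N) zero    _         = trans (ℤₚ.+-identityˡ _) (sum-below N zero z≤n)
sum-below (suc N) (suc t) (s≤s t≤N) = cong (λ w → 1ℤ + w) (sum-below N t t≤N)

ways-full : ∀ {N} (u : List (Fin N)) s → Distinct u → length u ℕ.+ s ≡ N → ways u (replicate s full) ≡ + (s !)
ways-full     u zero    dist eq = refl
ways-full {N} u (suc s) dist eq = trans
  (ways-const u full (replicate s full) (+ (s !)) λ x _ x∉u →
    ways-full (x ∷ u) s (x∉u , dist) (trans (sym (ℕₚ.+-suc (length u) s)) eq))
  (trans (cong (_· + (s !)) (avail-≡ u full dist (All.universal (λ _ → tt) u) (sum-full N) eq)) (sym (!-suc s)))

-- With 1-based position i = j + 1 and value k = x + 1, the condition k < 2i becomes x < 2j + 1.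
lowRow highRow : ∀ {N} → ℕ → Row N
lowRow  j = below (suc (double j))
highRow j = not ∘ lowRow j

-- The rows of positions j+1, n+j+1, j+2, n+j+2, … in the order in which they are processed.
pairRows : ∀ {N} → ℕ → ℕ → List (Row N)
pairRows zero    j = []
pairRows (suc d) j = lowRow j ∷ highRow j ∷ pairRows d (suc j)

-- Invariant: of the 2j rows in the first j pairs, `s` were turned into full rows and wait at the
-- end of the list; the others are filled, with values inside `lowRow j`. So the next low row offers
-- 2j + 1 - (2j - s) = 1 + s choices. Its partner, the high row, is full minus low, which yields the
-- two terms of `Q`.
ways-pairRows : ∀ {N} d j (u : List (Fin N)) s → double (j ℕ.+ d) ≡ N →
  Distinct u → All (T ∘ lowRow j) u → length u ℕ.+ s ≡ double j →
  ways u (pairRows d j ++ replicate s full) ≡ Q d s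
ways-pairRows zero j u s N≡ dist all len =
  ways-full u s dist (trans len (trans (cong double (sym (ℕₚ.+-identityʳ j))) N≡))
ways-pairRows {N} (suc d) j u s N≡ dist all len = begin
  W (not ∘ l)                                                  ≡⟨ ring (W (not ∘ l)) (W l) ⟩
  (W (not ∘ l) + W l) - W l                                    ≡⟨ cong (_- W l) (ways-complement₂ u l l rest) ⟩
  W full - W l                                                 ≡⟨ cong₂ _-_ W-full W-l ⟩
  (1ℤ + + s) · Q d (suc s) - (1ℤ + + s) · (+ s · Q d s)        ∎
  where
  open ≡-Reasoning
  l : Row N
  l = lowRow j
  rest = pairRows d (suc j) ++ replicate s full
  W : Row N → ℤ
  W r = ways u (l ∷ r ∷ rest)
  ring : ∀ a b → a ≡ (a + b) - b
  ring = solve-∀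
  N≡′ : double (suc j ℕ.+ d) ≡ N
  N≡′ = trans (cong double (sym (ℕₚ.+-suc j d))) N≡
  double-mono : ∀ {m n} → m ≤ n → double m ≤ double n
  double-mono z≤n     = z≤n
  double-mono (s≤s p) = s≤s (s≤s (double-mono p))
  size : sum (ind ∘ l) ≡ + suc (double j)
  size = sum-below N (suc (double j))
    (ℕₚ.≤-trans (ℕₚ.n≤1+n _) (ℕₚ.≤-trans (double-mono (ℕₚ.m≤m+n (suc j) d)) (ℕₚ.≤-reflexive N≡′)))
  weaken : ∀ {v} → All (T ∘ l) v → All (T ∘ lowRow (suc j)) v
  weaken = All.map λ {x} lx → ℕₚ.<⇒<ᵇ (ℕₚ.≤-trans (ℕₚ.<ᵇ⇒< (toℕ x) _ lx) (ℕₚ.m≤n+m _ 2))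
  avail-l : avail u l ≡ 1ℤ + + s
  avail-l = avail-≡ u l dist all size (trans (ℕₚ.+-suc (length u) s) (cong suc len))
  W-full : W full ≡ (1ℤ + + s) · Q d (suc s)
  W-full = trans
    (ways-const u l (full ∷ rest) (Q d (suc s)) λ x lx x∉u → trans
      -- The new full row is postponed to the end, where it joins the `s` waiting ones.
      (ways-↭ (↭-sym (shift full (pairRows d (suc j)) (replicate s full))) (x ∷ u))
      (ways-pairRows d (suc j) (x ∷ u) (suc s) N≡′ (x∉u , dist) (weaken (lx ∷ all))
        (cong suc (trans (ℕₚ.+-suc (length u) s) (cong suc len)))))
    (cong (_· Q d (suc s)) avail-l)
  W-l : W l ≡ (1ℤ + + s) · (+ s · Q d s)
  W-l = trans
    (ways-const u l (l ∷ rest) (+ s · Q d s) λ x lx x∉u → trans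
      -- The second copy of `l` has lost `x`, so `s` choices remain.
      (ways-const (x ∷ u) l rest (Q d s) λ y ly y∉xu →
        ways-pairRows d (suc j) (y ∷ x ∷ u) s N≡′ (y∉xu , x∉u , dist) (weaken (ly ∷ lx ∷ all)) (cong (2 ℕ.+_) len))
      (cong (_· Q d s) (avail-≡ (x ∷ u) l (x∉u , dist) (lx ∷ all) size (cong suc len))))
    (cong (_· (+ s · Q d s)) avail-l)

-- From filtered lists of vectors to `ways`

length-filter-concatMap : ∀ {A B : Set} {P : B → Set} (P? : Decidable P) (g : A → List B) {n} (h : Fin n → A) →
  + length (filter P? (concatMap g (tabulate h))) ≡ sum (λ i → + length (filter P? (g (h i))))
length-filter-concatMap P? g {zero}  h = refl
length-filter-concatMap P? g {suc n} h = begin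
  + length (filter P? (xs ++ ys))                        ≡⟨ cong (λ zs → + length zs) (filter-++ P? xs ys) ⟩
  + length (filter P? xs ++ filter P? ys)                ≡⟨ cong +_ (length-++ (filter P? xs)) ⟩
  + (length (filter P? xs) ℕ.+ length (filter P? ys))
    ≡⟨ cong (λ w → + length (filter P? xs) + w) (length-filter-concatMap P? g (h ∘ suc)) ⟩
  sum (λ i → + length (filter P? (g (h i))))             ∎
  where
  open ≡-Reasoning
  xs = g (h zero)
  ys = concatMap g (tabulate (h ∘ suc))

length-filter-map : ∀ {A B : Set} {P : B → Set} (P? : Decidable P) (g : A → B) xs →
  length (filter P? (map g xs)) ≡ length (filter (P? ∘ g) xs)
length-filter-map P? g []       = refl
length-filter-map P? g (x ∷ xs) with does (P? (g x))
... | true  = cong suc (length-filter-map P? g xs)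
... | false = length-filter-map P? g xs

module _ {N : ℕ} where

  -- Recording the values of earlier positions in `u` makes the property pass from a vector to its
  -- tail.
  Valid : ∀ {m} → List (Fin N) → (Fin m → Row N) → Vec (Fin N) m → Set
  Valid u f v = (∀ i → T (f i (lookup v i))) × (∀ i → used u (lookup v i) ≡ false)
              × (∀ i j → lookup v i ≡ lookup v j → i ≡ j)

  used-∷ : ∀ u (x y : Fin N) → ¬ y ≡ x → used u y ≡ false → used (x ∷ u) y ≡ false
  used-∷ u x y y≢x y∉u with y ≟ x
  ... | yes y≡x = contradiction y≡x y≢x
  ... | no _    = y∉u

  used-∷⁻ : ∀ u (x y : Fin N) → used (x ∷ u) y ≡ false → ¬ y ≡ x × used u y ≡ false
  used-∷⁻ u x y h with y ≟ x
  ... | no y≢x = y≢x , h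

  Valid-∷ : ∀ {m} u (f : Fin (suc m) → Row N) x v → T (f zero x) → used u x ≡ false →
    Valid (x ∷ u) (f ∘ suc) v → Valid u f (x ∷ v)
  Valid-∷ u f x v fx x∉u (rows , fresh , inj) = rows′ , fresh′ , inj′
    where
    rows′ : ∀ i → T (f i (lookup (x ∷ v) i))
    rows′ zero    = fx
    rows′ (suc i) = rows i
    fresh-i : ∀ i → ¬ lookup v i ≡ x × used u (lookup v i) ≡ false
    fresh-i i = used-∷⁻ u x (lookup v i) (fresh i)
    fresh′ : ∀ i → used u (lookup (x ∷ v) i) ≡ false
    fresh′ zero    = x∉u
    fresh′ (suc i) with fresh-i i
    ... | _ , vi∉u = vi∉u
    inj′ : ∀ i j → lookup (x ∷ v) i ≡ lookup (x ∷ v) j → i ≡ j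
    inj′ zero    zero    eq = refl
    inj′ zero    (suc j) eq with fresh-i j
    ... | vj≢x , _ = contradiction (sym eq) vj≢x
    inj′ (suc i) zero    eq with fresh-i i
    ... | vi≢x , _ = contradiction eq vi≢x
    inj′ (suc i) (suc j) eq = cong suc (inj i j eq)

  Valid-∷⁻ : ∀ {m} u (f : Fin (suc m) → Row N) x v → Valid u f (x ∷ v) → Valid (x ∷ u) (f ∘ suc) v
  Valid-∷⁻ u f x v (rows , fresh , inj) =
    rows ∘ suc ,
    (λ i → used-∷ u x (lookup v i) (λ eq → contradiction (inj (suc i) zero eq) λ ()) (fresh (suc i))) ,
    (λ i j eq → suc-injective (inj (suc i) (suc j) eq))

  -- Any decidable predicate equivalent to `Valid u f` is allowed, so the induction can restrict
  -- `P?` to vectors with head `x` and enlarge `u`.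
  count-Valid : ∀ {m} u (f : Fin m → Row N) {P : Vec (Fin N) m → Set} (P? : Decidable P) →
    (∀ v → P v → Valid u f v) → (∀ v → Valid u f v → P v) →
    + length (filter P? (allVecs N m)) ≡ ways u (tabulate f)
  count-Valid {zero}  u f P? to from with P? []
  ... | yes _ = refl
  ... | no ¬p = contradiction (from [] ((λ ()) , (λ ()) , (λ ()))) ¬p
  count-Valid {suc m} u f {P} P? to from = trans
    (length-filter-concatMap P? (λ x → map (x ∷_) (allVecs N m)) id)
    (sum-cong-≗ λ x → trans (cong +_ (length-filter-map P? (x ∷_) (allVecs N m))) (byHead x))
    where
    count : Fin N → ℤ
    count x = + length (filter (λ v → P? (x ∷ v)) (allVecs N m))
    none : ∀ x → (∀ v → ¬ P (x ∷ v)) → count x ≡ 0ℤ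
    none x ¬P = cong (λ vs → + length vs) (filter-none (λ v → P? (x ∷ v)) (All.universal ¬P (allVecs N m)))
    byHead : ∀ x → count x ≡ waysFrom u (f zero) (tabulate (f ∘ suc)) x
    byHead x with f zero x in fx | used u x in x∈u
    ... | false | _     = none x λ v p → case-row (to (x ∷ v) p)
      where
      case-row : ∀ {v} → ¬ Valid u f (x ∷ v)
      case-row (rows , _) = subst T fx (rows zero)
    ... | true  | true  = none x λ v p → case-used (to (x ∷ v) p)
      where
      case-used : ∀ {v} → ¬ Valid u f (x ∷ v)
      case-used (_ , fresh , _) with trans (sym x∈u) (fresh zero)
      ... | ()
    ... | true  | false = trans
      (count-Valid (x ∷ u) (f ∘ suc) (λ v → P? (x ∷ v))
        (λ v p → Valid-∷⁻ u f x v (to (x ∷ v) p))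
        (λ v ok → from (x ∷ v) (Valid-∷ u f x v (subst T (sym fx) tt) x∈u ok)))
      (sym (trans (ℤₚ.*-identityˡ _) (ℤₚ.*-identityˡ _)))

-- The bounds of the definition as rows

⌊1+k/2⌋≤⇒ : ∀ k i → ⌊ suc k /2⌋ ≤ i → k ≤ double i
⌊1+k/2⌋≤⇒ zero          i       _       = z≤n
⌊1+k/2⌋≤⇒ (suc zero)    (suc i) _       = s≤s z≤n
⌊1+k/2⌋≤⇒ (suc (suc k)) (suc i) (s≤s h) = s≤s (s≤s (⌊1+k/2⌋≤⇒ k i h))

⌊1+k/2⌋≤⇐ : ∀ k i → k ≤ double i → ⌊ suc k /2⌋ ≤ i
⌊1+k/2⌋≤⇐ zero          i       _             = z≤n
⌊1+k/2⌋≤⇐ (suc zero)    (suc i) _             = s≤s z≤n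
⌊1+k/2⌋≤⇐ (suc (suc k)) (suc i) (s≤s (s≤s h)) = s≤s (⌊1+k/2⌋≤⇐ k i h)

⌈double/2⌉ : ∀ n → ⌈ double n /2⌉ ≡ n
⌈double/2⌉ zero    = refl
⌈double/2⌉ (suc n) = cong suc (⌈double/2⌉ n)

lowerBd-double : ∀ n k → lowerBd (double n) k ≡ suc ⌊ k /2⌋
lowerBd-double n k = cong (λ b → if b then suc ⌊ k /2⌋ else ⌈ k /2⌉) (isEven-double n)

upperBd-double : ∀ n k → upperBd (double n) k ≡ n ℕ.+ ⌊ k /2⌋
upperBd-double n k = cong (ℕ._+ ⌊ k /2⌋) (⌈double/2⌉ n)

-- On the first n positions only the lower bound of the definition can fail, on the last n only the upper one.
positionRow : ∀ {N} → ℕ → ℕ → Row N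
positionRow n i = if i <ᵇ n then lowRow i else highRow (i ∸ n)

T-not⇒¬T : ∀ b → T (not b) → ¬ T b
T-not⇒¬T false _ ()

¬T⇒T-not : ∀ b → ¬ T b → T (not b)
¬T⇒T-not true  ¬b = ¬b tt
¬T⇒T-not false _  = tt

module _ (n : ℕ) (x : Fin (double n)) (i : ℕ) where

  private
    k = toℕ x
    h = ⌊ suc k /2⌋

    h≤n : h ≤ n
    h≤n = ⌊1+k/2⌋≤⇐ k n (ℕₚ.<⇒≤ (toℕ<n x))

    InBounds : Set
    InBounds = (lowerBd (double n) (suc k) ≤ suc i) × (suc i ≤ upperBd (double n) (suc k))

    lowRow⇒ : ∀ j → T (lowRow j x) → h ≤ j
    lowRow⇒ j t = ⌊1+k/2⌋≤⇐ k j (ℕₚ.≤-pred (ℕₚ.<ᵇ⇒< k _ t))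

    lowRow⇐ : ∀ j → h ≤ j → T (lowRow j x)
    lowRow⇐ j p = ℕₚ.<⇒<ᵇ (s≤s (⌊1+k/2⌋≤⇒ k j p))

  positionRow⇒ : T (positionRow n i x) → InBounds
  positionRow⇒ t rewrite lowerBd-double n (suc k) | upperBd-double n (suc k) with i <ᵇ n in eq
  ... | true  = s≤s (lowRow⇒ i t) ,
                ℕₚ.≤-trans (ℕₚ.<ᵇ⇒< i n (subst T (sym eq) tt)) (ℕₚ.m≤m+n n h)
  -- The 1-based value is at most 2n, whence h ≤ n ≤ i.
  ... | false = s≤s (ℕₚ.≤-trans h≤n n≤i) , i<n+h
    where
    n≤i : n ≤ i
    n≤i = ℕₚ.≮⇒≥ λ i<n → subst T eq (ℕₚ.<⇒<ᵇ i<n)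
    j<h : i ∸ n < h
    j<h = ℕₚ.≰⇒> λ h≤j → T-not⇒¬T (lowRow (i ∸ n) x) t (lowRow⇐ (i ∸ n) h≤j)
    i<n+h : i < n ℕ.+ h
    i<n+h = subst (_< n ℕ.+ h) (ℕₚ.m+[n∸m]≡n n≤i) (ℕₚ.+-monoʳ-< n j<h)

  positionRow⇐ : InBounds → T (positionRow n i x)
  positionRow⇐ (lo , hi) rewrite lowerBd-double n (suc k) | upperBd-double n (suc k) with i <ᵇ n in eq
  ... | true  = lowRow⇐ i (ℕₚ.≤-pred lo)
  ... | false = ¬T⇒T-not (lowRow (i ∸ n) x) λ t → ℕₚ.<⇒≱ j<h (lowRow⇒ (i ∸ n) t)
    where
    n≤i : n ≤ i
    n≤i = ℕₚ.≮⇒≥ λ i<n → subst T eq (ℕₚ.<⇒<ᵇ i<n)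
    j<h : i ∸ n < h
    j<h = ℕₚ.+-cancelˡ-< n (i ∸ n) h (subst (_< n ℕ.+ h) (sym (ℕₚ.m+[n∸m]≡n n≤i)) hi)

-- Regrouping positions into pairs, and conclusion

tabulate-toℕ : ∀ {A : Set} (g : ℕ → A) n → tabulate {n = n} (g ∘ toℕ) ≡ applyUpTo g n
tabulate-toℕ g zero    = refl
tabulate-toℕ g (suc n) = cong (g 0 ∷_) (tabulate-toℕ (g ∘ suc) n)

applyUpTo-+ : ∀ {A : Set} (g : ℕ → A) m n → applyUpTo g (m ℕ.+ n) ≡ applyUpTo g m ++ applyUpTo (λ j → g (m ℕ.+ j)) n
applyUpTo-+ g zero    n = refl
applyUpTo-+ g (suc m) n = cong (g 0 ∷_) (applyUpTo-+ (g ∘ suc) m n)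

-- `applyUpTo` advances by composing with `suc`, so both sequences stay abstract, tied only
-- pointwise to the rows from `j` on.
pairRows-↭ : ∀ {N} d j (l r : ℕ → Row N) → (∀ i → l i ≡ lowRow (j ℕ.+ i)) → (∀ i → r i ≡ highRow (j ℕ.+ i)) →
  applyUpTo l d ++ applyUpTo r d ↭ pairRows d j
pairRows-↭ zero    j l r l≡ r≡ = ↭.refl
pairRows-↭ (suc d) j l r l≡ r≡ = ↭.trans
  (prep (l 0) (shift (r 0) (applyUpTo (l ∘ suc) d) (applyUpTo (r ∘ suc) d)))
  (↭.trans (↭-reflexive (cong₂ (λ a b → a ∷ b ∷ applyUpTo (l ∘ suc) d ++ applyUpTo (r ∘ suc) d)
                               (head l lowRow l≡) (head r highRow r≡)))
         (prep _ (prep _ (pairRows-↭ d (suc j) (l ∘ suc) (r ∘ suc) (next l lowRow l≡) (next r highRow r≡)))))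
  where
  head : ∀ (g f : ℕ → Row _) → (∀ i → g i ≡ f (j ℕ.+ i)) → g 0 ≡ f j
  head g f eq = trans (eq 0) (cong f (ℕₚ.+-identityʳ j))
  next : ∀ (g f : ℕ → Row _) → (∀ i → g i ≡ f (j ℕ.+ i)) → ∀ i → g (suc i) ≡ f (suc j ℕ.+ i)
  next g f eq i = trans (eq (suc i)) (cong f (ℕₚ.+-suc j i))

positionRows-↭ : ∀ {N} n → applyUpTo (positionRow {N} n) (double n) ↭ pairRows n 0
positionRows-↭ {N} n = ↭.trans (↭-reflexive split) (pairRows-↭ n 0 lowRow highRow (λ _ → refl) (λ _ → refl))
  where
  double≡+ : ∀ n → double n ≡ n ℕ.+ n
  double≡+ n = trans (double≡2* n) (cong (n ℕ.+_) (ℕₚ.+-identityʳ n))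
  low : ∀ i → i < n → positionRow {N} n i ≡ lowRow i
  low i i<n = cong (λ b → if b then lowRow i else highRow (i ∸ n)) (<ᵇ-true i<n)
  high : ∀ j → j < n → positionRow {N} n (n ℕ.+ j) ≡ highRow j
  high j _ = trans
    (cong (λ b → if b then lowRow (n ℕ.+ j) else highRow (n ℕ.+ j ∸ n)) (<ᵇ-false (ℕₚ.m≤m+n n j)))
    (cong highRow (ℕₚ.m+n∸m≡n n j))
  split : applyUpTo (positionRow {N} n) (double n) ≡ applyUpTo lowRow n ++ applyUpTo highRow n
  split = trans (cong (applyUpTo (positionRow n)) (double≡+ n))
    (trans (applyUpTo-+ (positionRow n) n n) (cong₂ _++_ (applyUpTo-cong n low) (applyUpTo-cong n high)))

numCollapsed≡Q : ∀ n → + numCollapsed (double n) ≡ Q n 0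
numCollapsed≡Q n = begin
  + numCollapsed (double n)                              ≡⟨ count-Valid [] row (collapsedPerm? {double n}) to from ⟩
  ways [] (tabulate row)                                 ≡⟨ cong (ways []) (tabulate-toℕ (positionRow n) (double n)) ⟩
  ways [] (applyUpTo (positionRow n) (double n))         ≡⟨ ways-↭ (positionRows-↭ n) [] ⟩
  ways [] (pairRows n 0)                                 ≡⟨ cong (ways []) (++-identityʳ (pairRows n 0)) ⟨
  ways [] (pairRows n 0 ++ [])                           ≡⟨ ways-pairRows n 0 [] 0 refl tt [] refl ⟩
  Q n 0                                                  ∎
  where
  open ≡-Reasoning
  row : Fin (double n) → Row (double n)
  row = positionRow n ∘ toℕ
  to : ∀ v → IsPerm v × Collapsed v → Valid [] row v
  to v (perm , coll) = (λ i → positionRow⇐ n (lookup v i) (toℕ i) (coll (lookup v i) i refl)) , (λ _ → refl) , perm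
  from : ∀ v → Valid [] row v → IsPerm v × Collapsed v
  from v (rows , _ , perm) = perm , λ { _ i refl → positionRow⇒ n (lookup v i) (toℕ i) (rows i) }

theorem4p3 : (n : ℕ) → 1 ≤ n → numCollapsed (2 * n) ≡ H n
theorem4p3 n 1≤n = ℤₚ.+-injective (trans
  (cong (λ N → + numCollapsed N) (sym (double≡2* n)))
  (trans (numCollapsed≡Q n) (Q≡H n 1≤n)))
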